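{- $\text{WSP}_2(=,\neq)$ and $\text{WSP}_3(=,\neq)$, parameterized by the number $k$ of steps, are fixed-parameter tractable (FPT).
   Context: A workflow specification is a directed acyclic graph $(S,E)$, where $S$ is a set of steps and $E\subseteq S\times S$. A constrained workflow authorization schema is a tuple $((S,E),U,A,C)$, where $(S,E)$ is a workflow specification, $U$ is a set of users, $A\subseteq S\times U$ is an authorization policy (user $u$ is authorized for step $s$ iff $(s,u)\in A$), and $C$ is a set of workflow constraints. It is assumed that for every $s\in S$ there is some $u\in U$ with $(s,u)\in A$. A workflow constraint has the form $(\rho,S_1,S_2)$ with $S_1,S_2\subseteq S$ and $\rho\subseteq U\times U$. A plan is a function $\pi:S\to U$. It is authorized if $(s,\pi(s))\in A$ for all $s\in S$. It satisfies the constraint $(\rho,S_1,S_2)$ if there exist $s_1\in S_1$ and $s_2\in S_2$ with $(\pi(s_1),\pi(s_2))\in\rho$. It is valid if it is authorized and satisfies all constraints in $C$. The Workflow Satisfiability Problem (WSP): given a constrained workflow authorization schema, find a valid plan or answer that none exists. The order on steps plays no role. A constraint $(\rho,S_1,S_2)$ is of Type 1 if $S_1$ and $S_2$ are both singletons, of Type 2 if at least one of $S_1,S_2$ is a singleton, and of Type 3 if $S_1,S_2$ are arbitrary sets. The symbol $=$ denotes the diagonal relation $\Delta=\{(u,u):u\in U\}$ and $\neq$ denotes its complement in $U\times U$. $\text{WSP}_i(=,\neq)$ is the special case of WSP in which every constraint has the form $(\rho,S',S'')$ with $\rho\in\{=,\neq\}$, $S',S''\subseteq S$, and there are no constraints of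 Type $j$ for $j>i$ (so $\text{WSP}_2$ allows constraints of Types 1 and 2, and $\text{WSP}_3$ allows arbitrary sets $S',S''$). A problem with parameter $k$ is FPT if it can be solved by an algorithm running in time $O(f(k)N^d)$, where $N$ is the size of the input, $f$ is a function of $k$ only, and $d$ is a constant independent of $k$ and $N$. The parameter of WSP is $k=|S|$. -}

module Defs where

open import Data.Bool using (Bool; true; false)
open import Data.Fin using (Fin; toℕ)
open import Data.Fin.Subset using (Subset; _∈_; ⁅_⁆)
open import Data.List using (List; []; _∷_)
open import Data.List.Relation.Unary.All using (All)
open import Data.Nat using (ℕ; zero; suc; _+_; _*_; _^_; _≤_)
open import Data.Product using (Σ-syntax; ∃-syntax; _×_)
open import Data.Sum using (_⊎_)
open import Data.Unit using (⊤)
open import Data.Vec using (Vec; []; _∷_; lookup; tabulate; toList)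
open import Level using (Level; 0ℓ)
open import Relation.Binary using (Rel)
open import Relation.Binary.Construct.Closure.Transitive using (TransClosure)
open import Relation.Binary.PropositionalEquality using (_≡_; _≢_)
open import Relation.Nullary using (¬_)

------------------------------------------------------------------------
-- Model of computation
--
-- A first-order, call-by-value functional language with general recursion
-- on binary trees (in the style of Jones, "Computability and Complexity
-- from a Programming Perspective").  Every evaluation step costs one unit.
-- With trees stored as shared, immutable cells, each step takes constant
-- time up to the pointer arithmetic, so this measure of time and that of
-- Turing machines are polynomially related.

data Tree : Set where
  nil : Tree
  _∙_ : Tree → Tree → Tree

infixr 5 _∙_

size : Tree → ℕ
size nil     = 1
size (a ∙ b) = suc (size a + size b)

-- Exp ar n: expressions with n free variables (de Bruijn indices) that may
-- call any of m functions, the f-th one taking ar f arguments.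
data Exp {m : ℕ} (ar : Fin m → ℕ) (n : ℕ) : Set where
  var   : Fin n → Exp ar n
  nil   : Exp ar n
  cons  : Exp ar n → Exp ar n → Exp ar n
  case  : Exp ar n → Exp ar n → Exp ar (suc (suc n)) → Exp ar n
  let′  : Exp ar n → Exp ar (suc n) → Exp ar n
  call  : (f : Fin m) → Vec (Exp ar n) (ar f) → Exp ar n

record Program : Set where
  field
    {functions} : ℕ
    arity       : Fin functions → ℕ
    body        : (f : Fin functions) → Exp arity (arity f)
    main        : Exp arity 1

module Semantics (P : Program) where
  open Program P

  infix 4 _⊢_⇓_after_ _⊢_⇓*_after_

  mutual
    -- ρ ⊢ e ⇓ v after t: in environment ρ, e evaluates to v in t steps.
    data _⊢_⇓_after_ {n} (ρ : Vec Tree n) : Exp arity n → Tree → ℕ → Set where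
      var : ∀ x → ρ ⊢ var x ⇓ lookup ρ x after 1
      nil : ρ ⊢ nil ⇓ nil after 1
      cons : ∀ {e₁ e₂ v₁ v₂ t₁ t₂} →
        ρ ⊢ e₁ ⇓ v₁ after t₁ →
        ρ ⊢ e₂ ⇓ v₂ after t₂ →
        ρ ⊢ cons e₁ e₂ ⇓ v₁ ∙ v₂ after suc (t₁ + t₂)
      case-nil : ∀ {e e₁ e₂ v t t₁} →
        ρ ⊢ e ⇓ nil after t →
        ρ ⊢ e₁ ⇓ v after t₁ →
        ρ ⊢ case e e₁ e₂ ⇓ v after suc (t + t₁)
      case-cons : ∀ {e e₁ e₂ a b v t t₂} →
        ρ ⊢ e ⇓ a ∙ b after t →
        a ∷ b ∷ ρ ⊢ e₂ ⇓ v after t₂ →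
        ρ ⊢ case e e₁ e₂ ⇓ v after suc (t + t₂)
      let′ : ∀ {e₁ e₂ v₁ v₂ t₁ t₂} →
        ρ ⊢ e₁ ⇓ v₁ after t₁ →
        v₁ ∷ ρ ⊢ e₂ ⇓ v₂ after t₂ →
        ρ ⊢ let′ e₁ e₂ ⇓ v₂ after suc (t₁ + t₂)
      call : ∀ {f es vs v t₁ t₂} →
        ρ ⊢ es ⇓* vs after t₁ →
        vs ⊢ body f ⇓ v after t₂ →
        ρ ⊢ call f es ⇓ v after suc (t₁ + t₂)

    data _⊢_⇓*_after_ {n} (ρ : Vec Tree n) :
           ∀ {l} → Vec (Exp arity n) l → Vec Tree l → ℕ → Set where
      [] : ρ ⊢ [] ⇓* [] after 0
      _∷_ : ∀ {l} {e : Exp arity n} {es : Vec (Exp arity n) l} {v vs t ts} →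
        ρ ⊢ e ⇓ v after t →
        ρ ⊢ es ⇓* vs after ts →
        ρ ⊢ e ∷ es ⇓* v ∷ vs after (t + ts)

Runs : Program → Tree → Tree → ℕ → Set
Runs P input output t = input ∷ [] ⊢ main ⇓ output after t
  where
  open Program P
  open Semantics P

------------------------------------------------------------------------
-- Fixed-parameter tractability

record ParameterizedProblem : Set₁ where
  field
    Instance  : Set
    parameter : Instance → ℕ
    encode    : Instance → Tree
    Answer    : Instance → Tree → Set

FPT : ParameterizedProblem → Set
FPT Q =
  Σ[ P ∈ Program ] Σ[ f ∈ (ℕ → ℕ) ] ∃[ c ] ∃[ d ]
    ((x : Instance) → ∃[ y ] ∃[ t ]
       ( Runs P (encode x) y t
       × t ≤ c * (f (parameter x) * size (encode x) ^ d)
       × Answer x y ))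
  where open ParameterizedProblem Q

------------------------------------------------------------------------
-- Constrained workflow authorization schemas with steps Fin k and users
-- Fin n

private
  variable
    r : Level
    R : Set r
    k n : ℕ

-- R is what a constraint may specify its binary relation by: relations on
-- users themselves (R = Rel (Fin n) 0ℓ) or symbols denoting such relations.
record Constraint (R : Set r) (k : ℕ) : Set r where
  constructor ⟨_,_,_⟩
  field
    ρ     : R
    S₁ S₂ : Subset k

Edge : Vec (Subset k) k → Rel (Fin k) 0ℓ
Edge E s s′ = s′ ∈ lookup E s

Acyclic : Vec (Subset k) k → Set
Acyclic E = ∀ s → ¬ TransClosure (Edge E) s s

record Schema (R : Set r) (k n : ℕ) : Set r where
  field
    E           : Vec (Subset k) k
    acyclic     : Acyclic E
    -- The entry of A at user u is the set of steps u is authorized for.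
    A           : Vec (Subset k) n
    C           : List (Constraint R k)

  Authorized : Fin k → Fin n → Set
  Authorized s u = s ∈ lookup A u

  field
    authorizable : ∀ s → ∃[ u ] Authorized s u

Plan : ℕ → ℕ → Set
Plan k n = Fin k → Fin n

Satisfies : Plan k n → Constraint (Rel (Fin n) 0ℓ) k → Set
Satisfies π ⟨ ρ , S₁ , S₂ ⟩ =
  ∃[ s₁ ] ∃[ s₂ ] (s₁ ∈ S₁ × s₂ ∈ S₂ × ρ (π s₁) (π s₂))

interpret : (R → Rel (Fin n) 0ℓ) →
            Constraint R k → Constraint (Rel (Fin n) 0ℓ) k
interpret I ⟨ ρ , S₁ , S₂ ⟩ = ⟨ I ρ , S₁ , S₂ ⟩

-- I interprets the constraints' R as relations on users; for R = Rel (Fin n) 0ℓ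
-- it is the identity.
Valid : {R : Set r} → (R → Rel (Fin n) 0ℓ) → Schema R k n → Plan k n → Set r
Valid I W π =
  (∀ s → Authorized s (π s)) ×
  All (λ c → Satisfies π (interpret I c)) C
  where open Schema W

------------------------------------------------------------------------
-- Constraint types

data ConstraintType : Set where
  type1 type2 type3 : ConstraintType

IsSingleton : Subset k → Set
IsSingleton T = ∃[ s ] T ≡ ⁅ s ⁆

-- The types are cumulative: a constraint of Type 1 is also of Types 2 and 3.
HasType : ConstraintType → Constraint R k → Set
HasType type1 ⟨ _ , S₁ , S₂ ⟩ = IsSingleton S₁ × IsSingleton S₂
HasType type2 ⟨ _ , S₁ , S₂ ⟩ = IsSingleton S₁ ⊎ IsSingleton S₂
HasType type3 _               = ⊤

data Symbol : Set where
  `=` `≠` : Symbol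

⟦_⟧ : Symbol → Rel (Fin n) 0ℓ
⟦ `=` ⟧ = _≡_
⟦ `≠` ⟧ = _≢_

------------------------------------------------------------------------
-- Encodings of instances and answers as trees

encBool : Bool → Tree
encBool false = nil
encBool true  = nil ∙ nil

encℕ : ℕ → Tree
encℕ zero    = nil
encℕ (suc i) = nil ∙ encℕ i

encList : {X : Set} → (X → Tree) → List X → Tree
encList enc []       = nil
encList enc (x ∷ xs) = enc x ∙ encList enc xs

encVec : {X : Set} → (X → Tree) → Vec X n → Tree
encVec enc xs = encList enc (toList xs)

encSubset : Subset k → Tree
encSubset = encVec encBool

encSymbol : Symbol → Tree
encSymbol `=` = nil
encSymbol `≠` = nil ∙ nil

encConstraint : Constraint Symbol k → Tree
encConstraint ⟨ ρ , S₁ , S₂ ⟩ = encSymbol ρ ∙ encSubset S₁ ∙ encSubset S₂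

-- The numbers of steps and users are the lengths of the lists encoding E
-- and A; in particular, both are at most the size of the encoding.
encSchema : Schema Symbol k n → Tree
encSchema W = encVec encSubset E ∙ encVec encSubset A ∙ encList encConstraint C
  where open Schema W

encPlan : Plan k n → Tree
encPlan π = encVec (λ u → encℕ (toℕ u)) (tabulate π)

noPlan : Tree
noPlan = nil

somePlan : Plan k n → Tree
somePlan π = nil ∙ encPlan π

------------------------------------------------------------------------
-- WSPᵢ(=,≠), parameterized by the number of steps

record WSPInstance (i : ConstraintType) : Set where
  field
    {steps users} : ℕ
    schema        : Schema Symbol steps users
    typed         : All (HasType i) (Schema.C schema)

WSP : ConstraintType → ParameterizedProblem
WSP i = record
  { Instance  = WSPInstance i
  ; parameter = WSPInstance.steps
  ; encode    = λ x → encSchema (WSPInstance.schema x)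
  ; Answer    = λ x y →
      let W = WSPInstance.schema x in
        (∃[ π ] (Valid ⟦_⟧ W π × y ≡ somePlan π))
      ⊎ ((¬ (∃[ π ] Valid ⟦_⟧ W π)) × y ≡ noPlan)
  }

{-# OPTIONS --safe #-}
module Submission where

-- Two users with the same authorization set are interchangeable in a plan, as
-- long as distinct users stay distinct, and a plan uses at most k users.  Hence
-- it is enough to keep k + 1 users of each of the at most 2^k authorization
-- sets: if a plan uses a user u that was dropped, then by the pigeonhole
-- principle one of the k + 1 users kept for the set of u is not used by the
-- plan and can replace u everywhere.  Trying all plans over the remaining
-- 2^k (k + 1) users takes time quadratic in the input for fixed k.

open import Defs
open import Data.Bool using (Bool; true; false; not; _∧_; _∨_; if_then_else_)
open import Data.Fin as Fin using (Fin; zero; suc; toℕ; #_; fromℕ<)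
open import Data.Fin.Properties using (toℕ<n; toℕ-injective; toℕ-fromℕ<; pigeonhole; any?)
open import Data.Fin.Subset using (Subset) renaming (_∈_ to _∈ₛ_)
open import Data.List as List using (List; []; _∷_; length; drop)
open import Data.List.Membership.Propositional using (_∈_; find)
open import Data.List.Membership.Propositional.Properties using (∈-tabulate⁺; ∈-allFin; ∈-lookup)
open import Data.List.Properties using (length-tabulate; map-tabulate; map-∘; map-id)
open import Data.List.Relation.Binary.Sublist.Propositional using (_⊆_; []; _∷_; _∷ʳ_; minimum)
open import Data.List.Relation.Binary.Sublist.Propositional.Properties using (All-resp-⊆; map⁺)
open import Data.List.Relation.Unary.All as All using (All; []; _∷_)
import Data.List.Relation.Unary.All.Properties as All
open import Data.List.Relation.Unary.AllPairs using (AllPairs; []; _∷_)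
open import Data.List.Relation.Unary.Any as Any using (here; there)
open import Data.List.Relation.Unary.Unique.Propositional using (Unique)
open import Data.List.Relation.Unary.Unique.Propositional.Properties using (allFin⁺)
open import Data.Maybe using (Maybe; just; nothing; _<∣>_)
open import Data.Nat
open import Data.Nat.Properties
open import Data.Nat.Tactic.RingSolver using (solve-∀)
open import Data.Product using (_×_; _,_; proj₁; proj₂; ∃-syntax)
open import Data.Sum as Sum using (_⊎_; inj₁; inj₂; [_,_]′)
open import Data.Vec using (Vec; []; _∷_; lookup; tabulate; toList; here; there)
open import Data.Vec.Properties
  using (length-toList; []=⇒lookup; lookup⇒[]=; lookup∘tabulate; tabulate∘lookup)
open import Function using (_∘_; id)
open import Relation.Binary.PropositionalEquality
open import Relation.Nullary
  using (¬_; yes; no; contradiction; Reflects; ofʸ; ofⁿ; invert; ¬-reflects; _×-reflects_; _⊎-reflects_)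
open import Relation.Nullary.Decidable using (True; ¬?; decidable-stable)
open import Relation.Nullary.Reflects using (fromEquivalence; det)

-- The program

-- Users are grouped without comparing their authorization sets pairwise: the list of users is split
-- on one bit of these sets after another, as in a radix sort, and the `2 ^ k` leaves of the
-- splitting are the groups. For fixed k this takes linear time. The quadratic factor comes from the
-- check of a complete plan alone. Users are unary numbers, so one comparison takes time up to their
-- number n, and such comparisons are made for every constraint. Since a plan is checked only when
-- complete, arbitrary sets `S₁` and `S₂` cost just another factor depending on k. All bounds have
-- the form `T * U`. In the end `T` depends on k alone, and the loops over users and over
-- constraints are charged to `U`.

pattern eqF     = zero
pattern relF    = suc eqF
pattern ex₂F    = suc relF
pattern ex₁F    = suc ex₂F
pattern allF    = suc ex₁F
pattern nthF    = suc allF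
pattern searchF = suc nthF
pattern tryF    = suc searchF
pattern numberF = suc tryF
pattern partF   = suc numberF
pattern takeF   = suc partF
pattern bucketF = suc takeF

arity : Fin 12 → ℕ
arity eqF     = 2
arity relF    = 3
arity ex₂F    = 4
arity ex₁F    = 5
arity allF    = 2
arity nthF    = 2
arity searchF = 4
arity tryF    = 5
arity numberF = 2
arity partF   = 2
arity takeF   = 3
arity bucketF = 4

private
  v : ∀ i {n} {i<n : True (i <? n)} → Exp arity n
  v i {i<n = i<n} = var (#_ i {m<n = i<n})

  ff tt : ∀ {n} → Exp arity n
  ff = nil
  tt = cons nil nil

-- Above each body, its parameters, from de Bruijn index 0 upwards.
body : (f : Fin 12) → Exp arity (arity f)
-- eq a b
body eqF =
  case (v 0)
    (case (v 1) tt ff)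
    (case (v 3) ff (call eqF (v 3 ∷ v 1 ∷ [])))
-- rel ρ p q
body relF =
  case (v 0)
    (call eqF (v 1 ∷ v 2 ∷ []))
    (case (call eqF (v 3 ∷ v 4 ∷ [])) tt ff)
-- ex₂ ρ p S π
body ex₂F =
  case (v 2) ff
    (case (v 5) ff
      (case (v 2)
        (call ex₂F (v 4 ∷ v 5 ∷ v 3 ∷ v 1 ∷ []))
        (case (call relF (v 6 ∷ v 7 ∷ v 2 ∷ []))
          (call ex₂F (v 6 ∷ v 7 ∷ v 5 ∷ v 3 ∷ []))
          tt)))
-- ex₁ ρ S₂ π₀ S π
body ex₁F =
  case (v 3) ff
    (case (v 6) ff
      (case (v 2)
        (call ex₁F (v 4 ∷ v 5 ∷ v 6 ∷ v 3 ∷ v 1 ∷ []))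
        (case (call ex₂F (v 6 ∷ v 2 ∷ v 7 ∷ v 8 ∷ []))
          (call ex₁F (v 6 ∷ v 7 ∷ v 8 ∷ v 5 ∷ v 3 ∷ []))
          tt)))
-- all C π
body allF =
  case (v 0) tt
    (case (v 0) ff
      (case (v 1) ff
        (case (call ex₁F (v 2 ∷ v 1 ∷ v 7 ∷ v 0 ∷ v 7 ∷ []))
          ff
          (call allF (v 7 ∷ v 9 ∷ [])))))
-- nth bs i
body nthF =
  case (v 0) ff
    (case (v 3)
      (v 0)
      (call nthF (v 3 ∷ v 1 ∷ [])))
-- search fuel candidates π C: the plan is filled from the last step to the
-- first, so the length of fuel is the number of steps that π still lacks, and
-- in try the index of the step to be placed.
body searchF =
  case (v 0)
    (case (call allF (v 3 ∷ v 2 ∷ [])) nil (cons nil (v 4)))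
    (call tryF (v 3 ∷ v 1 ∷ v 3 ∷ v 4 ∷ v 5 ∷ []))
-- try untried fuel candidates π C
body tryF =
  case (v 0) nil
    (case (v 0) nil
      (case (call nthF (v 1 ∷ v 5 ∷ []))
        (call tryF (v 3 ∷ v 5 ∷ v 6 ∷ v 7 ∷ v 8 ∷ []))
        (case (call searchF (v 7 ∷ v 8 ∷ cons (v 2) (v 9) ∷ v 10 ∷ []))
          (call tryF (v 5 ∷ v 7 ∷ v 8 ∷ v 9 ∷ v 10 ∷ []))
          (cons (v 0) (v 1)))))
-- number i A
body numberF =
  case (v 1) nil
    (cons (cons (v 0) (cons (v 2) (v 0)))
          (call numberF (cons nil (v 2) ∷ v 1 ∷ [])))
-- part b us
body partF =
  case (v 1) nil
    (case (v 0) nil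
      (case (v 0) nil
        (let′ (call partF (v 6 ∷ v 5 ∷ []))
          (case (v 7)
            (case (v 1) (cons (cons (v 2) (v 4)) (v 0)) (v 2))
            (case (v 3) (v 2) (cons (cons (v 6) (v 8)) (v 4)))))))
-- take fuel us acc
body takeF =
  case (v 0) (v 2)
    (case (v 3) (v 4)
      (case (v 0) nil
        (cons (v 1) (call takeF (v 5 ∷ v 3 ∷ v 8 ∷ [])))))
-- bucket fuel limit us acc: each user comes with the bits of its authorization
-- set that remain to be split on; limit is the number of users kept at a leaf.
body bucketF =
  case (v 0)
    (call takeF (v 1 ∷ v 2 ∷ v 3 ∷ []))
    (call bucketF
      ( v 1 ∷ v 3 ∷ call partF (ff ∷ v 4 ∷ [])
      ∷ call bucketF (v 1 ∷ v 3 ∷ call partF (tt ∷ v 4 ∷ []) ∷ v 5 ∷ [])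
      ∷ []))

solver : Program
solver = record
  { arity = arity
  ; body  = body
  ; main  =
      case (v 0) nil
        (case (v 1) nil
          (call searchF
            ( v 2
            ∷ call bucketF
                -- `v 2` is the encoding of `E`, a list with one item per step. As fuel it makes the
                -- splitting run through all k bits, and with one more cell it is the limit k + 1.
                ( v 2 ∷ cons nil (v 2)
                ∷ call numberF (nil ∷ v 0 ∷ []) ∷ nil ∷ [])
            ∷ nil ∷ v 1 ∷ [])))
  }

open Semantics solver

-- Cost accounting

private
  variable
    j k n l U : ℕ
    ρ : Vec Tree n
    T T₁ T₂ : ℕ

mutual
  esize : Exp arity n → ℕ
  esize (var _)      = 1
  esize nil          = 1
  esize (cons e e₁)  = suc (esize e + esize e₁)
  esize (case e e₁ e₂) = suc (esize e + (esize e₁ + esize e₂))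
  esize (let′ e e₁)  = suc (esize e + esize e₁)
  esize (call f es)  = suc (esize* es)

  esize* : Vec (Exp arity n) l → ℕ
  esize* []       = 0
  esize* (e ∷ es) = esize e + esize* es

-- Opaque, since the numerals would otherwise be unfolded during unification.
opaque
  bsize : Fin 12 → ℕ
  bsize f = esize (body f)

  bsize-def : ∀ f → esize (body f) ≡ bsize f
  bsize-def f = refl

-- Time is counted in units of `U` steps, to keep the factor depending on k (in `T`) apart from the
-- one depending on the input size (in `U`). `rescale` moves factors between the two.
record Within (U : ℕ) (f : Fin 12) (vs : Vec Tree (arity f)) (y : Tree) (T : ℕ) : Set where
  constructor within
  field
    {time} : ℕ
    run    : vs ⊢ body f ⇓ y after time
    bound  : time ≤ T * U

-- No subexpression is evaluated twice within one activation of a function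
-- body, so esize e pays for all the steps of e itself, and only the
-- activations it calls contribute to T.
record Costs (U : ℕ) (ρ : Vec Tree n) (e : Exp arity n) (y : Tree) (T : ℕ) : Set where
  constructor costs
  field
    {time} : ℕ
    run    : ρ ⊢ e ⇓ y after time
    bound  : time ≤ (esize e + T) * U

record Costs* (U : ℕ) (ρ : Vec Tree n) (es : Vec (Exp arity n) l) (ys : Vec Tree l) (T : ℕ) : Set where
  constructor costs*
  field
    {time} : ℕ
    run    : ρ ⊢ es ⇓* ys after time
    bound  : time ≤ (esize* es + T) * U

+-bound : ∀ {t₁ t₂} s₁ s₂ T₁ T₂ →
  t₁ ≤ (s₁ + T₁) * U → t₂ ≤ (s₂ + T₂) * U →
  t₁ + t₂ ≤ (s₁ + s₂ + (T₁ + T₂)) * U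
+-bound {U} s₁ s₂ T₁ T₂ p q = ≤-trans (+-mono-≤ p q) (≤-reflexive (eq s₁ s₂ T₁ T₂ U))
  where
  eq : ∀ a b c d u → (a + c) * u + (b + d) * u ≡ (a + b + (c + d)) * u
  eq = solve-∀

module _ .{{_ : NonZero U}} where

  -- The slack `s₂ ≤ s₂′` is for `case`, where only one branch runs but `esize` counts both. The
  -- evaluation step itself costs 1, which is at most the nonzero `U`.
  step-bound : ∀ {t₁ t₂} s₁ {s₂ s₂′} T₁ T₂ → s₂ ≤ s₂′ →
    t₁ ≤ (s₁ + T₁) * U → t₂ ≤ (s₂ + T₂) * U →
    suc (t₁ + t₂) ≤ (suc (s₁ + s₂′) + (T₁ + T₂)) * U
  step-bound s₁ {s₂′ = s₂′} T₁ T₂ s₂≤s₂′ p q = +-mono-≤ (>-nonZero⁻¹ U)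
    (+-bound s₁ s₂′ T₁ T₂ p (≤-trans q (*-monoˡ-≤ U (+-monoˡ-≤ T₂ s₂≤s₂′))))

  unit-bound : 1 ≤ (1 + 0) * U
  unit-bound = ≤-trans (>-nonZero⁻¹ U) (m≤m+n U 0)

  var! : ∀ {x} → Costs U ρ (var x) (lookup ρ x) 0
  var! = costs (var _) unit-bound

  nil! : Costs U ρ nil nil 0
  nil! = costs nil unit-bound

  cons! : ∀ {e₁ e₂ y₁ y₂} → Costs U ρ e₁ y₁ T₁ → Costs U ρ e₂ y₂ T₂ →
    Costs U ρ (cons e₁ e₂) (y₁ ∙ y₂) (T₁ + T₂)
  cons! {e₁ = e₁} (costs r p) (costs s q) =
    costs (cons r s) (step-bound (esize e₁) _ _ ≤-refl p q)

  let! : ∀ {e₁ e₂ y₁ y₂} → Costs U ρ e₁ y₁ T₁ → Costs U (y₁ ∷ ρ) e₂ y₂ T₂ →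
    Costs U ρ (let′ e₁ e₂) y₂ (T₁ + T₂)
  let! {e₁ = e₁} (costs r p) (costs s q) =
    costs (let′ r s) (step-bound (esize e₁) _ _ ≤-refl p q)

  nil? : ∀ {e e₁ e₂ y} → Costs U ρ e nil T₁ → Costs U ρ e₁ y T₂ →
    Costs U ρ (case e e₁ e₂) y (T₁ + T₂)
  nil? {e = e} {e₁} {e₂} (costs r p) (costs s q) =
    costs (case-nil r s) (step-bound (esize e) _ _ (m≤m+n (esize e₁) (esize e₂)) p q)

  cons? : ∀ {e e₁ e₂ a b y} → Costs U ρ e (a ∙ b) T₁ → Costs U (a ∷ b ∷ ρ) e₂ y T₂ →
    Costs U ρ (case e e₁ e₂) y (T₁ + T₂)
  cons? {e = e} {e₁} {e₂} (costs r p) (costs s q) =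
    costs (case-cons r s) (step-bound (esize e) _ _ (m≤n+m (esize e₂) (esize e₁)) p q)

  []! : Costs* U ρ [] [] 0
  []! = costs* [] z≤n

  infixr 5 _∷!_
  _∷!_ : ∀ {l} {e} {es : Vec _ l} {y ys} → Costs U ρ e y T₁ → Costs* U ρ es ys T₂ →
    Costs* U ρ (e ∷ es) (y ∷ ys) (T₁ + T₂)
  _∷!_ {e = e} {es} (costs r p) (costs* s q) =
    costs* (r ∷ s) (+-bound (esize e) (esize* es) _ _ p q)

  call! : ∀ {f es y} {vs : Vec Tree (arity f)} → Costs* U ρ es vs T₁ → Within U f vs y T₂ →
    Costs U ρ (call f es) y (T₁ + T₂)
  call! {T₁ = T₁} {T₂ = T₂} {es = es} (costs* r p) (within s q) =
    costs (call r s) (subst (λ z → _ ≤ (suc z + (T₁ + T₂)) * U) (+-identityʳ (esize* es))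
      (step-bound (esize* es) {0} T₁ T₂ ≤-refl p q))

  relax : ∀ {e : Exp arity n} {y} → Costs U ρ e y T₁ → T₁ ≤ T₂ → Costs U ρ e y T₂
  relax {e = e} (costs r p) q = costs r (≤-trans p (*-monoˡ-≤ U (+-monoʳ-≤ (esize e) q)))

  inBody : ∀ {f y B} {vs : Vec Tree (arity f)} →
    Costs U vs (body f) y T → bsize f + T ≤ B → Within U f vs y B
  inBody {f = f} (costs r p) q =
    within r (≤-trans p (*-monoˡ-≤ U (≤-trans (+-monoˡ-≤ _ (≤-reflexive (bsize-def f))) q)))

rescale : ∀ {f y} {vs : Vec Tree (arity f)} U′ T′ → Within U f vs y T → T * U ≤ T′ * U′ → Within U′ f vs y T′
rescale _ _ (within r p) q = within r (≤-trans p q)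

-- The left side is a loop of `m` passes of cost `s` in unit 1. In unit `N` the whole loop costs no
-- more than one pass.
unroll : ∀ {m N} s → m ≤ N → m * s * 1 ≤ s * N
unroll {m} {N} s m≤N = begin
  m * s * 1 ≡⟨ *-identityʳ _ ⟩
  m * s     ≤⟨ *-monoˡ-≤ s m≤N ⟩
  N * s     ≡⟨ *-comm N s ⟩
  s * N     ∎
  where open ≤-Reasoning

+0≤ : ∀ {m} → m + 0 ≤ m
+0≤ = ≤-reflexive (+-identityʳ _)

-- The cost `suc m * (s + T)` of a loop computes to `(s + T) + R`, one pass and the rest. This lemma
-- is for a pass that continues with the recursive call, `loop-stop` for one that ends the loop.
loop-step : ∀ s {T′ T} R → T′ ≤ T → s + (T′ + R) ≤ (s + T) + R
loop-step s {T′} {T} R p =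
  ≤-trans (≤-reflexive (sym (+-assoc s T′ R))) (+-monoˡ-≤ R (+-monoʳ-≤ s p))

loop-stop : ∀ s {T′ T} R → T′ ≤ T → s + T′ ≤ (s + T) + R
loop-stop s R p = ≤-trans (+-monoʳ-≤ s p) (m≤m+n _ R)

-- Running times of the functions

module _ {X : Set} where

  exists : (X → Bool) → List Bool → List X → Bool
  exists p (true ∷ bs)  (x ∷ xs) = p x ∨ exists p bs xs
  exists p (false ∷ bs) (x ∷ xs) = exists p bs xs
  exists p _            _        = false

nth : List Bool → ℕ → Bool
nth []       _       = false
nth (b ∷ _)  zero    = b
nth (_ ∷ bs) (suc i) = nth bs i

encBools : List Bool → Tree
encBools = encList encBool

encUser : Fin n → Tree
encUser u = encℕ (toℕ u)

encUsers : List (Fin n) → Tree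
encUsers = encList encUser

rel : Symbol → Fin n → Fin n → Bool
rel `=` p q = toℕ p ≡ᵇ toℕ q
rel `≠` p q = not (toℕ p ≡ᵇ toℕ q)

eq-run : ∀ a b → Within 1 eqF (encℕ a ∷ encℕ b ∷ []) (encBool (a ≡ᵇ b)) (suc a * bsize eqF)
eq-run zero    zero    = inBody (nil? var! (nil? var! (cons! nil! nil!))) ≤-refl
eq-run zero    (suc b) = inBody (nil? var! (cons? var! nil!)) ≤-refl
eq-run (suc a) zero    = inBody (cons? var! (nil? var! nil!)) (+-monoʳ-≤ (bsize eqF) z≤n)
eq-run (suc a) (suc b) = inBody (cons? var! (cons? var! (call! (var! ∷! var! ∷! []!) (eq-run a b))))
  ≤-refl

-- In a unit `U` with `n ≤ U`, a unary comparison of two users costs only `bsize eqF`, so the costs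
-- that follow depend on the number of steps and not on the number of users.
relCost : ℕ
relCost = bsize relF + bsize eqF

ex₂Cost : ℕ → ℕ
ex₂Cost k = suc k * (bsize ex₂F + relCost)

ex₁Cost : ℕ → ℕ → ℕ
ex₁Cost k₂ k₁ = suc k₁ * (bsize ex₁F + ex₂Cost k₂)

checkCost : ℕ → ℕ
checkCost k = bsize allF + ex₁Cost k k

mutual
  -- `L` bounds the number of candidates and the last argument is the number of steps left to place.
  -- Every level multiplies by `suc L`, which is harmless once `L` is bounded in terms of k.
  searchCost : ℕ → ℕ → ℕ → ℕ
  searchCost k L zero    = bsize searchF + checkCost k
  searchCost k L (suc j) = bsize searchF + tryCost k L j L

  tryCost : ℕ → ℕ → ℕ → ℕ → ℕ
  tryCost k L j l = suc l * (bsize tryF + (suc k * bsize nthF + searchCost k L j))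

bucketCost : ℕ → ℕ → ℕ
bucketCost zero    m = bsize bucketF + suc m * bsize takeF
bucketCost (suc j) m = bsize bucketF + (bsize partF + (bsize partF + bucketCost j m) + bucketCost j m)

module _ .{{_ : NonZero U}} (n≤U : n ≤ U) where

  rel-run : ∀ σ (p q : Fin n) →
    Within U relF (encSymbol σ ∷ encUser p ∷ encUser q ∷ []) (encBool (rel σ p q)) relCost
  rel-run σ p q = go σ
    where
    eq-run′ : Within U eqF (encUser p ∷ encUser q ∷ []) (encBool (toℕ p ≡ᵇ toℕ q)) (bsize eqF)
    eq-run′ = rescale _ _ (eq-run (toℕ p) (toℕ q)) (unroll (bsize eqF) (≤-trans (toℕ<n p) n≤U))
    go : ∀ σ → Within U relF (encSymbol σ ∷ encUser p ∷ encUser q ∷ []) (encBool (rel σ p q)) relCost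
    go `=` = inBody (nil? var! (call! (var! ∷! var! ∷! []!) eq-run′)) ≤-refl
    go `≠` with toℕ p ≡ᵇ toℕ q | eq-run′
    ... | false | r = inBody (cons? var! (nil? (call! (var! ∷! var! ∷! []!) r) (cons! nil! nil!)))
        (+-monoʳ-≤ (bsize relF) +0≤)
    ... | true  | r = inBody (cons? var! (cons? (call! (var! ∷! var! ∷! []!) r) nil!))
        (+-monoʳ-≤ (bsize relF) +0≤)

  ex₂-run : ∀ σ (p : Fin n) S (π : List (Fin n)) →
    Within U ex₂F (encSymbol σ ∷ encUser p ∷ encBools S ∷ encUsers π ∷ [])
      (encBool (exists (rel σ p) S π)) (ex₂Cost (length S))
  ex₂-run σ p [] π = inBody (nil? var! nil!) (loop-stop (bsize ex₂F) 0 z≤n)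
  ex₂-run σ p (true ∷ S) [] = inBody (cons? var! (nil? var! nil!)) (loop-stop (bsize ex₂F) _ z≤n)
  ex₂-run σ p (false ∷ S) [] = inBody (cons? var! (nil? var! nil!)) (loop-stop (bsize ex₂F) _ z≤n)
  ex₂-run σ p (false ∷ S) (q ∷ π) =
    inBody (cons? var! (cons? var! (nil? var!
      (call! (var! ∷! var! ∷! var! ∷! var! ∷! []!) (ex₂-run σ p S π)))))
      (loop-step (bsize ex₂F) _ z≤n)
  ex₂-run σ p (true ∷ S) (q ∷ π) with rel σ p q | rel-run σ p q
  ... | true | r =
    inBody (cons? var! (cons? var! (cons? var!
      (cons? (call! (var! ∷! var! ∷! var! ∷! []!) r) (cons! nil! nil!)))))
      (loop-stop (bsize ex₂F) _ +0≤)
  ... | false | r =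
    inBody (cons? var! (cons? var! (cons? var!
      (nil? (call! (var! ∷! var! ∷! var! ∷! []!) r)
        (call! (var! ∷! var! ∷! var! ∷! var! ∷! []!) (ex₂-run σ p S π))))))
      (loop-step (bsize ex₂F) _ ≤-refl)

  ex₁-run : ∀ σ S₂ (π₀ : List (Fin n)) S π →
    Within U ex₁F (encSymbol σ ∷ encBools S₂ ∷ encUsers π₀ ∷ encBools S ∷ encUsers π ∷ [])
      (encBool (exists (λ p → exists (rel σ p) S₂ π₀) S π)) (ex₁Cost (length S₂) (length S))
  ex₁-run σ S₂ π₀ [] π = inBody (nil? var! nil!) (loop-stop (bsize ex₁F) 0 z≤n)
  ex₁-run σ S₂ π₀ (true ∷ S) [] = inBody (cons? var! (nil? var! nil!)) (loop-stop (bsize ex₁F) _ z≤n)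
  ex₁-run σ S₂ π₀ (false ∷ S) [] = inBody (cons? var! (nil? var! nil!))
    (loop-stop (bsize ex₁F) _ z≤n)
  ex₁-run σ S₂ π₀ (false ∷ S) (p ∷ π) =
    inBody (cons? var! (cons? var! (nil? var!
      (call! (var! ∷! var! ∷! var! ∷! var! ∷! var! ∷! []!) (ex₁-run σ S₂ π₀ S π)))))
      (loop-step (bsize ex₁F) _ z≤n)
  ex₁-run σ S₂ π₀ (true ∷ S) (p ∷ π) with exists (rel σ p) S₂ π₀ | ex₂-run σ p S₂ π₀
  ... | true | r =
    inBody (cons? var! (cons? var! (cons? var!
      (cons? (call! (var! ∷! var! ∷! var! ∷! var! ∷! []!) r) (cons! nil! nil!)))))
      (loop-stop (bsize ex₁F) _ +0≤)
  ... | false | r =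
    inBody (cons? var! (cons? var! (cons? var!
      (nil? (call! (var! ∷! var! ∷! var! ∷! var! ∷! []!) r)
        (call! (var! ∷! var! ∷! var! ∷! var! ∷! var! ∷! []!) (ex₁-run σ S₂ π₀ S π))))))
      (loop-step (bsize ex₁F) _ ≤-refl)

satisfies : Constraint Symbol k → List (Fin n) → Bool
satisfies ⟨ σ , S₁ , S₂ ⟩ π =
  exists (λ p → exists (rel σ p) (toList S₂) π) (toList S₁) π

allSatisfied : List (Constraint Symbol k) → List (Fin n) → Bool
allSatisfied []      π = true
allSatisfied (c ∷ C) π = satisfies c π ∧ allSatisfied C π

module _ .{{_ : NonZero U}} (n≤U : n ≤ U) where

  all-run : ∀ (C : List (Constraint Symbol k)) (π : List (Fin n)) →
    Within U allF (encList encConstraint C ∷ encUsers π ∷ [])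
      (encBool (allSatisfied C π)) (suc (length C) * checkCost k)
  all-run [] π = inBody (nil? var! (cons! nil! nil!)) (loop-stop (bsize allF) 0 z≤n)
  all-run (c@(⟨ σ , S₁ , S₂ ⟩) ∷ C) π
    with satisfies c π | ex₁-run n≤U σ (toList S₂) π (toList S₁) π
  ... | b | r rewrite length-toList S₁ | length-toList S₂ with b
  ... | false =
    inBody (cons? var! (cons? var! (cons? var!
      (nil? (call! (var! ∷! var! ∷! var! ∷! var! ∷! var! ∷! []!) r) nil!))))
      (loop-stop (bsize allF) _ +0≤)
  ... | true =
    inBody (cons? var! (cons? var! (cons? var!
      (cons? (call! (var! ∷! var! ∷! var! ∷! var! ∷! var! ∷! []!) r)
        (call! (var! ∷! var! ∷! []!) (all-run C π))))))
      (loop-step (bsize allF) _ ≤-refl)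

-- Any tree can serve as a unary counter through its right spine. Hence the encoding of `E` can be
-- used as the number k, and the program never has to compute k.
spine : Tree → ℕ
spine nil     = 0
spine (_ ∙ F) = suc (spine F)

nth-run : .{{_ : NonZero U}} → ∀ bs F →
  Within U nthF (encBools bs ∷ F ∷ []) (encBool (nth bs (spine F))) (suc (length bs) * bsize nthF)
nth-run []       F       = inBody (nil? var! nil!) ≤-refl
nth-run (b ∷ bs) nil     = inBody (cons? var! (nil? var! var!)) (+-monoʳ-≤ (bsize nthF) z≤n)
nth-run (b ∷ bs) (_ ∙ F) = inBody (cons? var! (cons? var! (call! (var! ∷! var! ∷! []!) (nth-run bs F))))
  ≤-refl

-- Backtracking search over the candidates

module Search {X : Set} (candidates : List X) (ok : X → ℕ → Bool) (check : List X → Bool) where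

  mutual
    search : ℕ → List X → Maybe (List X)
    search zero    π = if check π then just π else nothing
    search (suc j) π = try j π candidates

    try : ℕ → List X → List X → Maybe (List X)
    try j π []       = nothing
    try j π (c ∷ cs) = if ok c j then search j (c ∷ π) <∣> try j π cs else try j π cs

encPlan? : Maybe (List (Fin n)) → Tree
encPlan? nothing  = nil
encPlan? (just π) = nil ∙ encUsers π

module _ (A : Vec (Subset k) n) where

  -- The authorization set travels with the user, so the search tests authorization by reading one
  -- of k bits instead of walking through `A`.
  encCandidate : Fin n → Tree
  encCandidate u = encUser u ∙ encSubset (lookup A u)

  module _ (candidates : List (Fin n)) (C : List (Constraint Symbol k)) where

    open Search candidates (λ u → nth (toList (lookup A u))) (allSatisfied C)

    module _ .{{_ : NonZero U}} {L : ℕ} (candidates≤L : length candidates ≤ L)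
      -- The check loops over all constraints, yet is charged a cost in k only; the unit must be
      -- large enough to absorb that loop.
      (check-run : ∀ (π : List (Fin n)) → Within U allF (encList encConstraint C ∷ encUsers π ∷ [])
        (encBool (allSatisfied C π)) (checkCost k)) where

      mutual
        search-run : ∀ F π →
          Within U searchF (F ∷ encList encCandidate candidates ∷ encUsers π ∷ encList encConstraint C ∷ [])
            (encPlan? (search (spine F) π)) (searchCost k L (spine F))
        search-run nil π with allSatisfied C π | check-run π
        ... | false | r = inBody (nil? var! (nil? (call! (var! ∷! var! ∷! []!) r) nil!))
            (+-monoʳ-≤ (bsize searchF) +0≤)
        ... | true  | r = inBody (nil? var! (cons? (call! (var! ∷! var! ∷! []!) r) (cons! nil! var!)))
            (+-monoʳ-≤ (bsize searchF) +0≤)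
        search-run (_ ∙ F) π =
          inBody (cons? var! (call! (var! ∷! var! ∷! var! ∷! var! ∷! var! ∷! []!) (try-run F π candidates)))
            (+-monoʳ-≤ (bsize searchF) (*-monoˡ-≤ _ (s≤s candidates≤L)))

        try-run : ∀ F π cs →
          Within U tryF
            ( encList encCandidate cs ∷ F ∷ encList encCandidate candidates
            ∷ encUsers π ∷ encList encConstraint C ∷ [])
            (encPlan? (try (spine F) π cs)) (tryCost k L (spine F) (length cs))
        try-run F π [] = inBody (nil? var! nil!) (loop-stop (bsize tryF) 0 z≤n)
        try-run F π (c ∷ cs)
          with nth (toList (lookup A c)) (spine F) | nth-run {U = U} (toList (lookup A c)) F
        ... | b | r rewrite length-toList (lookup A c) with b
        ... | false =
          inBody (cons? var! (cons? var! (nil? (call! (var! ∷! var! ∷! []!) r)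
            (call! (var! ∷! var! ∷! var! ∷! var! ∷! var! ∷! []!) (try-run F π cs)))))
            (loop-step (bsize tryF) _ (m≤m+n (suc k * bsize nthF) _))
        ... | true with search (spine F) (c ∷ π) | search-run F (c ∷ π)
        ... | nothing | s =
          inBody (cons? var! (cons? var! (cons? (call! (var! ∷! var! ∷! []!) r)
            (nil? (call! (var! ∷! var! ∷! cons! var! var! ∷! var! ∷! []!) s)
              (call! (var! ∷! var! ∷! var! ∷! var! ∷! var! ∷! []!) (try-run F π cs))))))
            (≤-trans (+-monoʳ-≤ (bsize tryF) (≤-reflexive (sym (+-assoc (suc k * bsize nthF) _ _))))
              (loop-step (bsize tryF) _ ≤-refl))
        ... | just _ | s =
          inBody (cons? var! (cons? var! (cons? (call! (var! ∷! var! ∷! []!) r)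
            (cons? (call! (var! ∷! var! ∷! cons! var! var! ∷! var! ∷! []!) s)
              (cons! var! var!)))))
            (loop-stop (bsize tryF) _ (+-monoʳ-≤ (suc k * bsize nthF) +0≤))

-- The counter `i` and the function `g` are general because the recursion moves to the tail of `A`,
-- whose users are numbered from `suc i`.
number-run : ∀ {X : Set} (enc : X → Tree) (A : Vec (Subset k) n) (g : Fin n → X) i →
  (∀ j → enc (g j) ≡ encSubset (lookup A j) ∙ encℕ (i + toℕ j) ∙ encSubset (lookup A j)) →
  Within 1 numberF (encℕ i ∷ encVec encSubset A ∷ [])
    (encList enc (List.tabulate g)) (suc n * bsize numberF)
number-run enc []      g i eq = inBody (nil? var! nil!) ≤-refl
number-run enc (a ∷ A) g i eq rewrite eq zero | +-identityʳ i =
  inBody (cons? var! (cons! (cons! var! (cons! var! var!))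
    (call! (cons! nil! var! ∷! var! ∷! []!)
      (number-run enc A (λ j → g (suc j)) (suc i)
        (λ j → trans (eq (suc j))
          (cong (λ m → encSubset (lookup A j) ∙ encℕ m ∙ encSubset (lookup A j)) (+-suc i (toℕ j))))))))
    ≤-refl

-- Grouping of users by authorization set

module Bucket {X : Set} (enc : X → Tree) where

  Entry : ℕ → Set
  Entry j = Vec Bool j × X

  encEntry : ∀ {j} → Entry j → Tree
  encEntry (r , x) = encSubset r ∙ enc x

  part : ∀ {j} → Bool → List (Entry (suc j)) → List (Entry j)
  part b     []                       = []
  part true  ((true  ∷ r , x) ∷ us) = (r , x) ∷ part true us
  part true  ((false ∷ r , x) ∷ us) = part true us
  part false ((true  ∷ r , x) ∷ us) = part false us
  part false ((false ∷ r , x) ∷ us) = (r , x) ∷ part false us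

  takeUsers : ∀ {j} → ℕ → List (Entry j) → List X → List X
  takeUsers zero    us             acc = acc
  takeUsers (suc m) []             acc = acc
  takeUsers (suc m) ((_ , x) ∷ us) acc = x ∷ takeUsers m us acc

  bucket : ∀ j → ℕ → List (Entry j) → List X → List X
  bucket zero    m us acc = takeUsers m us acc
  bucket (suc j) m us acc = bucket j m (part false us) (bucket j m (part true us) acc)

  length-part : ∀ {j} b (us : List (Entry (suc j))) → length (part b us) ≤ length us
  length-part b     []                     = z≤n
  length-part true  ((true  ∷ r , x) ∷ us) = s≤s (length-part true us)
  length-part true  ((false ∷ r , x) ∷ us) = m≤n⇒m≤1+n (length-part true us)
  length-part false ((true  ∷ r , x) ∷ us) = m≤n⇒m≤1+n (length-part false us)
  length-part false ((false ∷ r , x) ∷ us) = s≤s (length-part false us)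

  length-takeUsers : ∀ {j} m (us : List (Entry j)) acc → length (takeUsers m us acc) ≤ m + length acc
  length-takeUsers zero    us       acc = ≤-refl
  length-takeUsers (suc m) []       acc = m≤n+m (length acc) (suc m)
  length-takeUsers (suc m) (_ ∷ us) acc = s≤s (length-takeUsers m us acc)

  -- Splitting on `j` bits ends in `2 ^ j` leaves, and each leaf puts at most `m` users in front of
  -- the accumulator.
  length-bucket : ∀ j m (us : List (Entry j)) acc → length (bucket j m us acc) ≤ 2 ^ j * m + length acc
  length-bucket zero    m us acc =
    ≤-trans (length-takeUsers m us acc) (+-monoˡ-≤ (length acc) (m≤m+n m 0))
  length-bucket (suc j) m us acc = begin
    length (bucket j m (part false us) (bucket j m (part true us) acc))
      ≤⟨ length-bucket j m (part false us) _ ⟩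
    2 ^ j * m + length (bucket j m (part true us) acc)
      ≤⟨ +-monoʳ-≤ (2 ^ j * m) (length-bucket j m (part true us) acc) ⟩
    2 ^ j * m + (2 ^ j * m + length acc)
      ≡⟨ eq (2 ^ j) m (length acc) ⟩
    2 ^ suc j * m + length acc ∎
    where
    open ≤-Reasoning
    eq : ∀ p m l → p * m + (p * m + l) ≡ 2 * p * m + l
    eq = solve-∀

  part-run : ∀ {j} b (us : List (Entry (suc j))) →
    Within 1 partF (encBool b ∷ encList encEntry us ∷ [])
      (encList encEntry (part b us)) (suc (length us) * bsize partF)
  part-run true  [] = inBody (nil? var! nil!) ≤-refl
  part-run false [] = inBody (nil? var! nil!) ≤-refl
  part-run true ((true ∷ r , x) ∷ us) =
    inBody (cons? var! (cons? var! (cons? var! (let! (call! (var! ∷! var! ∷! []!) (part-run true us))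
      (cons? var! (cons? var! (cons! (cons! var! var!) var!)))))))
      (+-monoʳ-≤ (bsize partF) +0≤)
  part-run true ((false ∷ r , x) ∷ us) =
    inBody (cons? var! (cons? var! (cons? var! (let! (call! (var! ∷! var! ∷! []!) (part-run true us))
      (cons? var! (nil? var! var!))))))
      (+-monoʳ-≤ (bsize partF) +0≤)
  part-run false ((true ∷ r , x) ∷ us) =
    inBody (cons? var! (cons? var! (cons? var! (let! (call! (var! ∷! var! ∷! []!) (part-run false us))
      (nil? var! (cons? var! var!))))))
      (+-monoʳ-≤ (bsize partF) +0≤)
  part-run false ((false ∷ r , x) ∷ us) =
    inBody (cons? var! (cons? var! (cons? var! (let! (call! (var! ∷! var! ∷! []!) (part-run false us))
      (nil? var! (nil? var! (cons! (cons! var! var!) var!)))))))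
      (+-monoʳ-≤ (bsize partF) +0≤)

  module _ .{{_ : NonZero U}} where

    take-run : ∀ {j} F (us : List (Entry j)) acc →
      Within U takeF (F ∷ encList encEntry us ∷ encList enc acc ∷ [])
        (encList enc (takeUsers (spine F) us acc)) (suc (spine F) * bsize takeF)
    take-run nil     us       acc = inBody (nil? var! var!) ≤-refl
    take-run (_ ∙ F) []       acc = inBody (cons? var! (nil? var! var!)) (+-monoʳ-≤ (bsize takeF) z≤n)
    take-run (_ ∙ F) (_ ∷ us) acc =
      inBody (cons? var! (cons? var! (cons? var!
        (cons! var! (call! (var! ∷! var! ∷! var! ∷! []!) (take-run F us acc))))))
        ≤-refl

    part-run′ : ∀ {j} b (us : List (Entry (suc j))) → length us < U →
      Within U partF (encBool b ∷ encList encEntry us ∷ [])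
        (encList encEntry (part b us)) (bsize partF)
    part-run′ b us us<U = rescale _ _ (part-run b us) (unroll (bsize partF) us<U)

    -- Parts are never longer than the list they come from, so the one bound `length us < U` lasts
    -- through the recursion and every partition costs `bsize partF`.
    bucket-run : ∀ F M (us : List (Entry (spine F))) acc → length us < U →
      Within U bucketF (F ∷ M ∷ encList encEntry us ∷ encList enc acc ∷ [])
        (encList enc (bucket (spine F) (spine M) us acc)) (bucketCost (spine F) (spine M))
    bucket-run nil M us acc us<U =
      inBody (nil? var! (call! (var! ∷! var! ∷! var! ∷! []!) (take-run M us acc))) ≤-refl
    bucket-run (_ ∙ F) M us acc us<U =
      inBody (cons? var! (call!
        (var! ∷! var! ∷! call! (nil! ∷! var! ∷! []!) (part-run′ false us us<U)
        ∷! call! (var! ∷! var! ∷! call! (cons! nil! nil! ∷! var! ∷! []!) (part-run′ true us us<U) ∷! var! ∷! []!)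
             (bucket-run F M (part true us) acc (≤-<-trans (length-part true us) us<U))
        ∷! []!)
        (bucket-run F M (part false us) _ (≤-<-trans (length-part false us) us<U))))
        (≤-reflexive (eq (bsize bucketF) (bsize partF) (bucketCost (spine F) (spine M))))
      where
      eq : ∀ s p b → s + (p + (p + 0 + b + 0) + b) ≡ s + (p + (p + b) + b)
      eq = solve-∀

-- The whole solver and its running time

module _ (W : Schema Symbol k n) where
  open Schema W
  open Bucket (encCandidate A)

  entries : List (Entry k)
  entries = List.tabulate λ u → lookup A u , u

  candidates : List (Fin n)
  candidates = bucket k (suc k) entries []

  open Search candidates (λ u → nth (toList (lookup A u))) (allSatisfied C) public
    using () renaming (search to findPlan)

maxCandidates : ℕ → ℕ
maxCandidates k = 2 ^ k * suc k

mainCost : ℕ → ℕ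
mainCost k =
  esize (Program.main solver) +
  (bsize numberF + bucketCost k (suc k) + searchCost k (maxCandidates k) k)

spine-encVec : ∀ {X : Set} (enc : X → Tree) (xs : Vec X k) → spine (encVec enc xs) ≡ k
spine-encVec enc []       = refl
spine-encVec enc (_ ∷ xs) = cong suc (spine-encVec enc xs)

module _ (W : Schema Symbol k n) {N : ℕ} .{{_ : NonZero N}} where
  open Schema W
  open Bucket (encCandidate A)

  private
    instance
      N²≢0 : NonZero (N * N)
      N²≢0 = m*n≢0 N N

  main-run : n < N → length C < N →
    Costs (N * N) (encSchema W ∷ []) (Program.main solver) (encPlan? (findPlan W k []))
      (bsize numberF + bucketCost k (suc k) + searchCost k (maxCandidates k) k)
  main-run n<N C<N = relax
    (cons? var! (cons? var! (call!
      ( var!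
      ∷! call!
           ( var! ∷! cons! nil! var!
           ∷! call! (nil! ∷! var! ∷! []!) number′ ∷! nil! ∷! []!)
           bucket′
      ∷! nil! ∷! var! ∷! []!)
      search′)))
    (≤-reflexive (eq (bsize numberF) (bucketCost k (suc k)) _))
    where
    eq : ∀ a b c → a + 0 + b + 0 + c ≡ a + b + c
    eq = solve-∀

    fuel : Tree
    fuel = encVec encSubset E

    number′ : Within (N * N) numberF (nil ∷ encVec encSubset A ∷ [])
      (encList encEntry (entries W)) (bsize numberF)
    number′ = rescale _ _ (number-run encEntry A (λ u → lookup A u , u) 0 (λ _ → refl))
      (unroll (bsize numberF) (≤-trans n<N (m≤m*n N N)))

    -- The type of the entries in `bucket-run` depends on `spine F`, which equals k only
    -- propositionally. With a variable `j` for k the equation can be matched with `refl`.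
    bucket-fuel : ∀ F {j} → spine F ≡ j → (us : List (Entry j)) → length us < N →
      Within N bucketF (F ∷ (nil ∙ F) ∷ encList encEntry us ∷ nil ∷ [])
        (encList (encCandidate A) (bucket j (suc j) us [])) (bucketCost j (suc j))
    bucket-fuel F refl us us<N = bucket-run F (nil ∙ F) us [] us<N

    bucket′ : Within (N * N) bucketF (fuel ∷ (nil ∙ fuel) ∷ encList encEntry (entries W) ∷ nil ∷ [])
      (encList (encCandidate A) (candidates W)) (bucketCost k (suc k))
    bucket′ = rescale _ _
      (bucket-fuel fuel (spine-encVec encSubset E) (entries W)
        (subst (_< N) (sym (length-tabulate _)) n<N))
      (*-monoʳ-≤ (bucketCost k (suc k)) (m≤m*n N N))

    candidates≤ : length (candidates W) ≤ maxCandidates k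
    candidates≤ = ≤-trans (length-bucket k (suc k) (entries W) []) +0≤

    check′ : ∀ π → Within (N * N) allF (encList encConstraint C ∷ encUsers π ∷ [])
      (encBool (allSatisfied C π)) (checkCost k)
    -- One factor `N` is the unit of the unary comparisons, the other bounds the passes over the
    -- constraints.
    check′ π = rescale _ _ (all-run (<⇒≤ n<N) C π) (begin
      suc (length C) * checkCost k * N ≤⟨ *-monoˡ-≤ N (*-monoˡ-≤ (checkCost k) C<N) ⟩
      N * checkCost k * N              ≡⟨ cong (_* N) (*-comm N (checkCost k)) ⟩
      checkCost k * N * N              ≡⟨ *-assoc (checkCost k) N N ⟩
      checkCost k * (N * N)            ∎)
      where open ≤-Reasoning

    search-fuel : ∀ F {j} → spine F ≡ j →
      Within (N * N) searchF (F ∷ encList (encCandidate A) (candidates W) ∷ nil ∷ encList encConstraint C ∷ [])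
        (encPlan? (findPlan W j [])) (searchCost k (maxCandidates k) j)
    search-fuel F refl = search-run A (candidates W) C candidates≤ check′ F []

    search′ : Within (N * N) searchF
      (fuel ∷ encList (encCandidate A) (candidates W) ∷ nil ∷ encList encConstraint C ∷ [])
      (encPlan? (findPlan W k [])) (searchCost k (maxCandidates k) k)
    search′ = search-fuel fuel (spine-encVec encSubset E)

-- Correctness

map-reflects : ∀ {P Q : Set} {b} → (P → Q) → (Q → P) → Reflects P b → Reflects Q b
map-reflects f g (ofʸ p)  = ofʸ (f p)
map-reflects f g (ofⁿ ¬p) = ofⁿ (¬p ∘ g)

exists-reflects : ∀ {X : Set} {P : X → Set} {p} → (∀ x → Reflects (P x) (p x)) →
  (S : Subset k) (xs : Vec X k) →
  Reflects (∃[ s ] (s ∈ₛ S × P (lookup xs s))) (exists p (toList S) (toList xs))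
exists-reflects r []          []       = ofⁿ λ ()
exists-reflects r (false ∷ S) (x ∷ xs) =
  map-reflects (λ (s , s∈S , px) → suc s , there s∈S , px)
    (λ { (suc s , there s∈S , px) → s , s∈S , px })
    (exists-reflects r S xs)
exists-reflects r (true ∷ S) (x ∷ xs) =
  map-reflects
    [ (λ px → zero , here , px) , (λ (s , s∈S , px) → suc s , there s∈S , px) ]′
    (λ { (zero , _ , px) → inj₁ px ; (suc s , there s∈S , px) → inj₂ (s , s∈S , px) })
    (r x ⊎-reflects exists-reflects r S xs)

rel-reflects : ∀ σ (p q : Fin n) → Reflects (⟦ σ ⟧ p q) (rel σ p q)
rel-reflects `=` p q =
  fromEquivalence (toℕ-injective ∘ ≡ᵇ⇒≡ (toℕ p) (toℕ q)) (≡⇒≡ᵇ (toℕ p) (toℕ q) ∘ cong toℕ)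
rel-reflects `≠` p q = ¬-reflects (rel-reflects `=` p q)

satisfies-reflects : ∀ c (π : Vec (Fin n) k) →
  Reflects (Satisfies (lookup π) (interpret ⟦_⟧ c)) (satisfies c (toList π))
satisfies-reflects ⟨ σ , S₁ , S₂ ⟩ π =
  map-reflects (λ (s₁ , s₁∈ , s₂ , s₂∈ , r) → s₁ , s₂ , s₁∈ , s₂∈ , r)
    (λ (s₁ , s₂ , s₁∈ , s₂∈ , r) → s₁ , s₁∈ , s₂ , s₂∈ , r)
    (exists-reflects (λ p → exists-reflects (rel-reflects σ p) S₂ π) S₁ π)

allSatisfied-reflects : ∀ C (π : Vec (Fin n) k) →
  Reflects (All (λ c → Satisfies (lookup π) (interpret ⟦_⟧ c)) C) (allSatisfied C (toList π))
allSatisfied-reflects []      π = ofʸ []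
allSatisfied-reflects (c ∷ C) π =
  map-reflects (λ (s , ss) → s ∷ ss) (λ { (s ∷ ss) → s , ss })
    (satisfies-reflects c π ×-reflects allSatisfied-reflects C π)

nth-lookup : ∀ (S : Subset k) s → nth (toList S) (toℕ s) ≡ lookup S s
nth-lookup (b ∷ S) zero    = refl
nth-lookup (b ∷ S) (suc s) = nth-lookup S s

drop-toℕ : ∀ {X : Set} (xs : Vec X k) s →
  drop (toℕ s) (toList xs) ≡ lookup xs s ∷ drop (suc (toℕ s)) (toList xs)
drop-toℕ (x ∷ xs) zero    = refl
drop-toℕ (x ∷ xs) (suc s) = drop-toℕ xs s

drop-all : ∀ {X : Set} (xs : Vec X k) → drop k (toList xs) ≡ []
drop-all []       = refl
drop-all (x ∷ xs) = drop-all xs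

-- Soundness and completeness of the search

module SearchProperties {X : Set} (candidates : List X) (ok : X → ℕ → Bool) (check : List X → Bool) where
  open Search candidates ok check

  -- These are the branches of the search tree, freed from the order in which candidates are tried;
  -- soundness and completeness both refer to them.
  data Extends : ℕ → List X → List X → Set where
    done  : ∀ {xs} → Extends zero xs xs
    place : ∀ {j c xs ys} → c ∈ candidates → ok c j ≡ true →
            Extends j (c ∷ xs) ys → Extends (suc j) xs ys

  mutual
    search-sound : ∀ j xs {ys} → search j xs ≡ just ys → Extends j xs ys × check ys ≡ true
    search-sound zero xs eq with check xs in checked
    search-sound zero xs refl | true = done , checked
    search-sound (suc j) xs eq = try-sound j xs candidates id eq

    try-sound : ∀ j xs cs {ys} → (∀ {c} → c ∈ cs → c ∈ candidates) →
      try j xs cs ≡ just ys → Extends (suc j) xs ys × check ys ≡ true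
    try-sound j xs (c ∷ cs) cs⊆ eq with ok c j in okay
    ... | false = try-sound j xs cs (cs⊆ ∘ there) eq
    ... | true with search j (c ∷ xs) in found
    ...   | nothing = try-sound j xs cs (cs⊆ ∘ there) eq
    try-sound j xs (c ∷ cs) cs⊆ refl | true | just _ =
      let ext , checked = search-sound j (c ∷ xs) found in place (cs⊆ (here refl)) okay ext , checked

  mutual
    -- An earlier branch may succeed with a plan other than `ys`, so the claim is only that the
    -- search does not fail.
    search-complete : ∀ {j xs ys} → Extends j xs ys → check ys ≡ true → search j xs ≢ nothing
    search-complete {xs = xs} done checked eq with check xs
    search-complete done refl () | true
    search-complete (place c∈ okay ext) checked eq = try-complete c∈ okay ext checked eq

    try-complete : ∀ {j c xs ys cs} → c ∈ cs → ok c j ≡ true →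
      Extends j (c ∷ xs) ys → check ys ≡ true → try j xs cs ≢ nothing
    try-complete {j} {c} {xs} (here refl) okay ext checked eq
      rewrite okay with search j (c ∷ xs) in found
    ... | nothing = search-complete ext checked found
    try-complete {j} {c} {xs} {cs = c′ ∷ cs} (there c∈) okay ext checked eq with ok c′ j
    ... | false = try-complete c∈ okay ext checked eq
    ... | true with search j (c′ ∷ xs)
    ...   | nothing = try-complete c∈ okay ext checked eq

  Placed : List X → ℕ → Set
  Placed ys m = ∃[ v ] (toList {n = m} v ≡ ys × ∀ s → ok (lookup v s) (toℕ s) ≡ true)

  -- The plan grows at its front: with `j` steps left, the users in `w` belong to the steps from `j`
  -- on, whence the shift `j + toℕ s`.
  extends-placed : ∀ {j i ys} (w : Vec X i) → Extends j (toList w) ys →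
    (∀ s → ok (lookup w s) (j + toℕ s) ≡ true) → Placed ys (j + i)
  extends-placed w done okays = w , refl , okays
  extends-placed {suc j} {i} w (place {c = c} _ okay ext) okays =
    subst (Placed _) (+-suc j i) (extends-placed (c ∷ w) ext λ where
      zero    → subst (λ m → ok c m ≡ true) (sym (+-identityʳ j)) okay
      (suc s) → subst (λ m → ok (lookup w s) m ≡ true) (sym (+-suc j (toℕ s))) (okays s))

  -- The search passes through the suffixes of `v`: with `j` steps left, its partial plan is `v`
  -- without the first `j` entries.
  placed-extends : (v : Vec X k) → (∀ s → lookup v s ∈ candidates) →
    (∀ s → ok (lookup v s) (toℕ s) ≡ true) → Extends k [] (toList v)
  placed-extends {k} v v∈ okays = subst (λ xs → Extends k xs (toList v)) (drop-all v) (go k ≤-refl)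
    where
    go : ∀ j → j ≤ k → Extends j (drop j (toList v)) (toList v)
    go zero    _   = done
    go (suc j) j<k = place (v∈ s) (subst (λ m → ok (lookup v s) m ≡ true) s≡j (okays s))
      (subst (λ xs → Extends j xs (toList v))
        (subst (λ m → drop m (toList v) ≡ lookup v s ∷ drop (suc m) (toList v)) s≡j (drop-toℕ v s))
        (go j (<⇒≤ j<k)))
      where
      s = fromℕ< j<k
      s≡j = toℕ-fromℕ< j<k

-- Which users the grouping keeps

module BucketProperties {X : Set} (enc : X → Tree) where
  open Bucket enc

  -- A sublist rather than mere membership, because it inherits distinctness: `ys` will be `m`
  -- different users.
  Full : ℕ → List (Entry j) → Vec Bool j → List X → Set
  Full m us r kept = ∃[ ys ] (length ys ≡ m × All (_∈ kept) ys × List.map (r ,_) ys ⊆ us)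

  part-∈ : ∀ {us b} {r : Vec Bool j} {x} → (b ∷ r , x) ∈ us → (r , x) ∈ part b us
  part-∈ {us = (true  ∷ _ , _) ∷ _} {true}  (here refl) = here refl
  part-∈ {us = (false ∷ _ , _) ∷ _} {false} (here refl) = here refl
  part-∈ {us = (true  ∷ _ , _) ∷ _} {true}  (there p) = there (part-∈ p)
  part-∈ {us = (false ∷ _ , _) ∷ _} {true}  (there p) = part-∈ p
  part-∈ {us = (true  ∷ _ , _) ∷ _} {false} (there p) = part-∈ p
  part-∈ {us = (false ∷ _ , _) ∷ _} {false} (there p) = there (part-∈ p)

  part-⊆ : ∀ us b {r : Vec Bool j} ys → List.map (r ,_) ys ⊆ part b us → List.map (b ∷ r ,_) ys ⊆ us
  part-⊆ us                     b     []          p          = minimum us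
  part-⊆ ((true  ∷ _ , _) ∷ us) true  ys@(_ ∷ _)  (_ ∷ʳ p)   = _ ∷ʳ part-⊆ us true ys p
  part-⊆ ((true  ∷ _ , _) ∷ us) true  (_ ∷ ys)    (refl ∷ p) = refl ∷ part-⊆ us true ys p
  part-⊆ ((false ∷ _ , _) ∷ us) true  ys@(_ ∷ _)  p          = _ ∷ʳ part-⊆ us true ys p
  part-⊆ ((true  ∷ _ , _) ∷ us) false ys@(_ ∷ _)  p          = _ ∷ʳ part-⊆ us false ys p
  part-⊆ ((false ∷ _ , _) ∷ us) false ys@(_ ∷ _)  (_ ∷ʳ p)   = _ ∷ʳ part-⊆ us false ys p
  part-⊆ ((false ∷ _ , _) ∷ us) false (_ ∷ ys)    (refl ∷ p) = refl ∷ part-⊆ us false ys p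

  take-acc : ∀ m (us : List (Entry j)) {acc x} → x ∈ acc → x ∈ takeUsers m us acc
  take-acc zero    us       p = p
  take-acc (suc m) []       p = p
  take-acc (suc m) (_ ∷ us) p = there (take-acc m us p)

  bucket-acc : ∀ j m us {acc x} → x ∈ acc → x ∈ bucket j m us acc
  bucket-acc zero    m us p = take-acc m us p
  bucket-acc (suc j) m us p = bucket-acc j m (part false us) (bucket-acc j m (part true us) p)

  take-∈ : ∀ m {us acc x} → ([] , x) ∈ us →
    x ∈ takeUsers m us acc ⊎ Full m us [] (takeUsers m us acc)
  take-∈ zero _ = inj₂ ([] , refl , [] , minimum _)
  take-∈ (suc m) (here refl) = inj₁ (here refl)
  take-∈ (suc m) {([] , y) ∷ us} (there p) with take-∈ m p
  ... | inj₁ x∈ = inj₁ (there x∈)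
  ... | inj₂ (ys , refl , ys∈ , ys⊆) =
    inj₂ (y ∷ ys , refl , here refl ∷ All.map there ys∈ , refl ∷ ys⊆)

  part-full : ∀ us b {m} {r : Vec Bool j} {kept kept′} → (∀ {x} → x ∈ kept → x ∈ kept′) →
    Full m (part b us) r kept → Full m us (b ∷ r) kept′
  part-full us b kept⊆ (ys , len , ys∈ , ys⊆) = ys , len , All.map kept⊆ ys∈ , part-⊆ us b ys ys⊆

  bucket-∈ : ∀ j m {us acc} r {x} → (r , x) ∈ us →
    x ∈ bucket j m us acc ⊎ Full m us r (bucket j m us acc)
  bucket-∈ zero m [] p = take-∈ m p
  bucket-∈ (suc j) m {us} (false ∷ r) p =
    Sum.map₂ (part-full us false id) (bucket-∈ j m r (part-∈ p))
  bucket-∈ (suc j) m {us} (true ∷ r) p =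
    Sum.map keep (part-full us true keep) (bucket-∈ j m r (part-∈ p))
    where
    keep : ∀ {x} → _
    keep {x} = bucket-acc j m (part false us) {x = x}

-- The exchange of dropped users for kept ones

lookup-AllPairs : ∀ {X : Set} {R : X → X → Set} {xs} → AllPairs R xs →
  ∀ {i j} → i Fin.< j → R (List.lookup xs i) (List.lookup xs j)
lookup-AllPairs (rs ∷ _)  {zero}  {suc j} _   = All.lookup rs (∈-lookup j)
lookup-AllPairs (_ ∷ rss) {suc i} {suc j} i<j = lookup-AllPairs rss (s<s⁻¹ i<j)

AllPairs-resp-⊆ : ∀ {X : Set} {R : X → X → Set} {xs ys} → xs ⊆ ys → AllPairs R ys → AllPairs R xs
AllPairs-resp-⊆ []         []         = []
AllPairs-resp-⊆ (_ ∷ʳ p)   (_ ∷ rss)  = AllPairs-resp-⊆ p rss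
AllPairs-resp-⊆ (refl ∷ p) (rs ∷ rss) = All-resp-⊆ p rs ∷ AllPairs-resp-⊆ p rss

-- Otherwise every position of `ys` has a step mapped to its user; two positions share such a step,
-- and their users coincide against uniqueness.
avoid-image : (π : Plan k n) (ys : List (Fin n)) → Unique ys → k < length ys →
  ∃[ y ] (y ∈ ys × ∀ s → π s ≢ y)
avoid-image {k} π ys unique k<len with Any.any? (λ y → ¬? (any? λ s → π s Fin.≟ y)) ys
... | yes p =
  let y , y∈ , y∉ = find p in y , y∈ , λ s πs≡y → y∉ (s , πs≡y)
... | no ¬p =
  let i , j , i<j , eq = pigeonhole k<len (proj₁ ∘ preimage) in
  contradiction
    (trans (sym (proj₂ (preimage i))) (trans (cong π eq) (proj₂ (preimage j))))
    (lookup-AllPairs unique i<j)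
  where
  preimage : ∀ i → ∃[ s ] π s ≡ List.lookup ys i
  preimage i = decidable-stable (any? λ s → π s Fin.≟ List.lookup ys i)
    (All.lookup (All.¬Any⇒All¬ ys ¬p) (∈-lookup i))

module _ (W : Schema Symbol k n) where
  open Schema W
  open BucketProperties (encCandidate A)

  -- The second components of `entries W` are all users, each once, so `ys` is a sublist of
  -- `allFin n`.
  full-users : ∀ r (ys : List (Fin n)) → List.map (r ,_) ys ⊆ entries W →
    Unique ys × All (λ y → lookup A y ≡ r) ys
  full-users r ys ys⊆ =
    AllPairs-resp-⊆ (subst₂ _⊆_ (trans (sym (map-∘ ys)) (map-id ys)) (map-tabulate _ proj₂) (map⁺ proj₂ ys⊆))
      (allFin⁺ n) ,
    All.map⁻ (All-resp-⊆ ys⊆ (All.tabulate⁺ {P = λ (r , y) → lookup A y ≡ r} λ _ → refl))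

  replacement : (π : Plan k n) (u : Fin n) →
    u ∈ candidates W ⊎ ∃[ u′ ] (u′ ∈ candidates W × lookup A u′ ≡ lookup A u × ∀ s → π s ≢ u′)
  replacement π u with bucket-∈ k (suc k) {entries W} {[]} (lookup A u) (∈-tabulate⁺ u)
  ... | inj₁ u∈ = inj₁ u∈
  ... | inj₂ (ys , len , ys∈ , ys⊆) =
    let unique , same = full-users _ ys ys⊆
        u′ , u′∈ , fresh = avoid-image π ys unique (≤-reflexive (sym len))
    in inj₂ (u′ , All.lookup ys∈ u′∈ , All.lookup same u′∈ , fresh)

  replace : Fin n → Fin n → Fin n → Fin n
  replace u u′ w with w Fin.≟ u
  ... | yes _ = u′
  ... | no  _ = w

  replace-self : ∀ u u′ → replace u u′ u ≡ u′
  replace-self u u′ with u Fin.≟ u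
  ... | yes _  = refl
  ... | no u≢u = contradiction refl u≢u

  replace-∈ : ∀ {us} u u′ w → u′ ∈ us → w ∈ us → replace u u′ w ∈ us
  replace-∈ u u′ w u′∈ w∈ with w Fin.≟ u
  ... | yes _ = u′∈
  ... | no  _ = w∈

  replace-authorized : ∀ {u u′ s} w → lookup A u′ ≡ lookup A u →
    Authorized s w → Authorized s (replace u u′ w)
  replace-authorized {u} {u′} {s} w same auth with w Fin.≟ u
  ... | yes refl = subst (s ∈ₛ_) (sym same) auth
  ... | no  _    = auth

  -- The map `replace u u′` identifies only `u` with `u′`. A plan that avoids `u′` therefore keeps
  -- distinct users distinct, which is what `≠` needs.
  replace-injective : ∀ u u′ {p q} → p ≢ u′ → q ≢ u′ → replace u u′ p ≡ replace u u′ q → p ≡ q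
  replace-injective u u′ {p} {q} p≢ q≢ eq with p Fin.≟ u | q Fin.≟ u
  ... | yes p≡u | yes q≡u = trans p≡u (sym q≡u)
  ... | yes _   | no  _   = contradiction (sym eq) q≢
  ... | no  _   | yes _   = contradiction eq p≢
  ... | no  _   | no  _   = eq

  replace-rel : ∀ σ u u′ {p q} → p ≢ u′ → q ≢ u′ → ⟦ σ ⟧ p q → ⟦ σ ⟧ (replace u u′ p) (replace u u′ q)
  replace-rel `=` u u′ p≢ q≢ p≡q = cong (replace u u′) p≡q
  replace-rel `≠` u u′ p≢ q≢ p≢q = p≢q ∘ replace-injective u u′ p≢ q≢

  replace-valid : ∀ {π : Plan k n} u u′ → lookup A u′ ≡ lookup A u → (∀ s → π s ≢ u′) →
    Valid ⟦_⟧ W π → Valid ⟦_⟧ W (replace u u′ ∘ π)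
  replace-valid {π} u u′ same fresh (auth , sat) =
    (λ s → replace-authorized (π s) same (auth s)) ,
    All.map (λ { {⟨ σ , _ , _ ⟩} (s₁ , s₂ , s₁∈ , s₂∈ , r) →
      s₁ , s₂ , s₁∈ , s₂∈ , replace-rel σ u u′ (fresh s₁) (fresh s₂) r }) sat

  -- Steps are repaired one by one. A replacement may change the user of steps repaired earlier, but
  -- it only brings in a kept user, so they stay repaired.
  exchange : ∃[ π ] Valid ⟦_⟧ W π → ∀ ss →
    ∃[ π ] (Valid ⟦_⟧ W π × All (λ s → π s ∈ candidates W) ss)
  exchange (π , valid) [] = π , valid , []
  exchange solvable (s ∷ ss) with exchange solvable ss
  ... | π , valid , π∈ with replacement π (π s)
  ...   | inj₁ πs∈ = π , valid , πs∈ ∷ π∈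
  ...   | inj₂ (u′ , u′∈ , same , fresh) =
    replace (π s) u′ ∘ π , replace-valid (π s) u′ same fresh valid ,
    subst (_∈ candidates W) (sym (replace-self (π s) u′)) u′∈ ∷
    All.map (replace-∈ (π s) u′ _ u′∈) π∈

  -- The search works on vectors, and `lookup (tabulate π)` agrees with `π` only pointwise.
  valid-cong : ∀ {π π′ : Plan k n} → (∀ s → π s ≡ π′ s) → Valid ⟦_⟧ W π → Valid ⟦_⟧ W π′
  valid-cong π≗π′ (auth , sat) =
    (λ s → subst (Authorized s) (π≗π′ s) (auth s)) ,
    All.map (λ { {⟨ σ , _ , _ ⟩} (s₁ , s₂ , s₁∈ , s₂∈ , r) →
      s₁ , s₂ , s₁∈ , s₂∈ , subst₂ ⟦ σ ⟧ (π≗π′ s₁) (π≗π′ s₂) r }) sat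

  open SearchProperties (candidates W) (λ u → nth (toList (lookup A u))) (allSatisfied C)

  findPlan-sound : ∀ {ys} → findPlan W k [] ≡ just ys →
    ∃[ π ] (Valid ⟦_⟧ W (lookup π) × toList π ≡ ys)
  findPlan-sound eq
    with ext , satisfied ← search-sound k [] eq
    with π , refl , okays ← subst (Placed _) (+-identityʳ k) (extends-placed [] ext λ ()) =
    π ,
    ( (λ s → lookup⇒[]= s _ (trans (sym (nth-lookup (lookup A (lookup π s)) s)) (okays s)))
    , invert (subst (Reflects _) satisfied (allSatisfied-reflects C π)) ) ,
    refl

  findPlan-complete : findPlan W k [] ≡ nothing → ¬ (∃[ π ] Valid ⟦_⟧ W π)
  findPlan-complete eq solvable
    with π , valid , π∈ ← exchange solvable (List.allFin k)
    with auth , sat ← valid-cong (sym ∘ lookup∘tabulate π) valid =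
    search-complete
      (placed-extends w
        (λ s → subst (_∈ candidates W) (sym (lookup∘tabulate π s)) (All.lookup π∈ (∈-allFin s)))
        (λ s → trans (nth-lookup (lookup A (lookup w s)) s) ([]=⇒lookup (auth s))))
      (det (allSatisfied-reflects C w) (ofʸ sat)) eq
    where
    w = tabulate π

-- Strictness pays for the pass of a loop that meets the end of the list.
length<size : ∀ {X : Set} (enc : X → Tree) xs → length xs < size (encList enc xs)
length<size enc []       = s≤s z≤n
length<size enc (x ∷ xs) = s≤s (≤-trans (length<size enc xs) (m≤n+m _ (size (enc x))))

module _ {i : ConstraintType} (x : WSPInstance i) where
  open WSPInstance x
  open Schema schema

  private
    N = size (encSchema schema)

  solver-run : ∃[ t ] (Runs solver (encSchema schema) (encPlan? (findPlan schema steps [])) t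
                       × t ≤ 1 * (mainCost steps * N ^ 2))
  solver-run =
    let costs run bound = main-run schema {N} users<N C<N in
    _ , run , ≤-trans bound (≤-reflexive (trans
      (cong (λ M → mainCost steps * (N * M)) (sym (*-identityʳ N)))
      (sym (*-identityˡ _))))
    where
    open ≤-Reasoning

    sizeA+C : ℕ
    sizeA+C = size (encVec encSubset A) + size (encList encConstraint C)

    sizeA+C≤N : sizeA+C ≤ N
    sizeA+C≤N = m≤n⇒m≤1+n (≤-trans (n≤1+n sizeA+C) (m≤n+m _ (size (encVec encSubset E))))

    users<N : users < N
    users<N = begin-strict
      users                     ≡⟨ length-toList A ⟨
      length (toList A)         <⟨ length<size encSubset (toList A) ⟩
      size (encVec encSubset A) ≤⟨ m≤m+n _ _ ⟩
      sizeA+C                   ≤⟨ sizeA+C≤N ⟩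
      N                         ∎
    C<N : length C < N
    C<N = begin-strict
      length C                       <⟨ length<size encConstraint C ⟩
      size (encList encConstraint C) ≤⟨ m≤n+m _ _ ⟩
      sizeA+C                        ≤⟨ sizeA+C≤N ⟩
      N                              ∎


  solver-answer : ParameterizedProblem.Answer (WSP i) x (encPlan? (findPlan schema steps []))
  solver-answer with findPlan schema steps [] in found
  ... | nothing = inj₂ (findPlan-complete schema found , refl)
  ... | just _ with π , valid , refl ← findPlan-sound schema found =
    inj₁ (lookup π , valid , cong (λ π → nil ∙ encVec encUser π) (sym (tabulate∘lookup π)))

wsp-fpt : ∀ i → FPT (WSP i)
wsp-fpt i = solver , mainCost , 1 , 2 , λ x →
  let t , run , bound = solver-run x in _ , t , run , bound , solver-answer x

corollary6 : FPT (WSP type2) × FPT (WSP type3)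
corollary6 = wsp-fpt type2 , wsp-fpt type3
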